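{- Let $A$ be a nonempty finite set of positive integers. Then \[ M(\sup A) \le \sum_{d=1}^{\sup A} \mu(d)\, 2^{v(A,d)}, \] and equality holds if and only if $\gcd(A)>1$.
   Context: $\sup A$ is the largest element of $A$. $\mu$ is the Möbius function and $M(N)=\sum_{d=1}^N\mu(d)$ is the Mertens function. For a positive integer $d$, $v(A,d)$ is the number of multiples of $d$ in $A$. -}

module Defs where

open import Data.Bool.Base using (if_then_else_)
open import Data.Integer.Base using (ℤ; 0ℤ; -1ℤ; _+_; _^_)
open import Data.List.Base using (List; length; filter)
open import Data.List.Extrema.Nat using (max)
open import Data.List.NonEmpty.Base using (List⁺; _∷_; toList; foldr₁)
import Data.List.Relation.Unary.Unique.DecPropositional as DecUnique
open import Data.Nat.Base using (ℕ; zero; suc; NonZero)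
open import Data.Nat.Divisibility using (_∣?_)
open import Data.Nat.GCD using (gcd)
open import Data.Nat.Primality.Factorisation using (factors; factorise)
open import Data.Nat.Properties using (_≟_)
open import Relation.Nullary.Decidable using (does)

open DecUnique _≟_ using (unique?)

∑₁ : ℕ → (ℕ → ℤ) → ℤ
∑₁ zero    f = 0ℤ
∑₁ (suc n) f = ∑₁ n f + f (suc n)

syntax ∑₁ N (λ d → e) = ∑[1≤ d ≤ N ] e

primeFactors : (n : ℕ) → .{{NonZero n}} → List ℕ
primeFactors n = factors (factorise n)

-- `primeFactors n` lists the prime factors of n with multiplicity, so it is
-- duplicate-free exactly when n is squarefree.  The value at 0 is a dummy.
μ : ℕ → ℤ
μ zero      = 0ℤ
μ n@(suc _) =
  if does (unique? (primeFactors n)) then -1ℤ ^ length (primeFactors n) else 0ℤ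

M : ℕ → ℤ
M N = ∑[1≤ d ≤ N ] μ d

-- A nonempty finite set of naturals is represented by a nonempty list without
-- repetitions; the absence of repetitions is a separate hypothesis, and is what
-- makes `v` count elements of the set.

sup : List⁺ ℕ → ℕ
sup (x ∷ xs) = max x xs

v : List⁺ ℕ → ℕ → ℕ
v A d = length (filter (d ∣?_) (toList A))

gcdSet : List⁺ ℕ → ℕ
gcdSet = foldr₁ gcd

{-# OPTIONS --safe #-}
-- Expand 2^v(A,d) as the number of subsets B of A all of whose elements are
-- multiples of d, that is, with d ∣ gcd B, and exchange the sums: the right-hand
-- side becomes the sum over B ⊆ A of Σ_{d ∣ gcd B} μ(d).  The empty set has gcd 0
-- and contributes M(sup A); a nonempty B contributes 1 if gcd B = 1 and 0
-- otherwise.  So the difference of the two sides counts the nonempty B ⊆ A with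
-- gcd B = 1, and such a B exists exactly when gcd A = 1.
module Submission where

open import Defs
import Algebra.Properties.AbelianGroup as AbelianGroup
open import Data.Bool.Base using (if_then_else_)
open import Data.Integer.Base as ℤ using (ℤ; 0ℤ; 1ℤ; -1ℤ; +_; _+_; _*_; -_; _≤_)
import Data.Integer.Properties as ℤ
open import Data.Integer.Tactic.RingSolver using (solve-∀)
open import Data.List.Base using (List; []; _∷_; length; filter; foldr)
open import Data.List.Extrema.Nat using (⊥≤max; xs≤max)
open import Data.List.NonEmpty.Base using (List⁺; _∷_; toList)
open import Data.List.Membership.Propositional using (_∈_; _∉_)
open import Data.List.Relation.Binary.Permutation.Propositional using (_↭_; ↭-sym; ↭⇒↭ₛ)
open import Data.List.Relation.Binary.Permutation.Propositional.Properties using (↭-length)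
import Data.List.Relation.Binary.Permutation.Setoid.Properties as Permutationₛ
open import Data.List.Relation.Unary.All using (All; []; _∷_)
open import Data.List.Relation.Unary.All.Properties using (All¬⇒¬Any; ¬Any⇒All¬)
open import Data.List.Relation.Unary.AllPairs as AllPairs using (_∷_)
open import Data.List.Relation.Unary.Unique.Propositional using (Unique)
import Data.List.Relation.Unary.Unique.DecPropositional as DecUnique
open import Data.Nat.Base as ℕ using (ℕ; zero; suc; _<_; _^_; NonZero; z<s; s≤s)
open import Data.Nat.Divisibility
open import Data.Nat.GCD
open import Data.Nat.ListAction using (product)
open import Data.Nat.ListAction.Properties using (∈⇒∣product)
open import Data.Nat.Primality using (Prime; ¬prime[1]; euclidsLemma; prime⇒nonZero; productOfPrimes≢0)
open import Data.Nat.Primality.Factorisation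
open import Data.Nat.Properties as ℕ using (_≟_)
open import Data.Product.Base using (_×_; _,_)
open import Data.Sum.Base using (inj₁; inj₂)
open import Function.Base using (_∘_; case_of_)
open import Function.Bundles using (_⇔_; mk⇔)
open import Relation.Binary.PropositionalEquality
open import Relation.Nullary
open import Relation.Nullary.Decidable using (dec-true; dec-false)

open AbelianGroup ℤ.+-0-abelianGroup using () renaming (∙-cancelˡ to +-cancelˡ)
open DecUnique _≟_ using (unique?)
open PrimeFactorisation using (isFactorisation; factorsPrime)
open ≡-Reasoning

-- Integer-valued indicators of decidable propositions.

private
  variable
    P Q : Set

⟦_⟧ : Dec P → ℤ
⟦ P? ⟧ = if does P? then 1ℤ else 0ℤ

⟦⟧-true : (P? : Dec P) → P → ⟦ P? ⟧ ≡ 1ℤ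
⟦⟧-true (yes _) _ = refl
⟦⟧-true (no ¬p) p = contradiction p ¬p

⟦⟧-false : (P? : Dec P) → ¬ P → ⟦ P? ⟧ ≡ 0ℤ
⟦⟧-false (yes p) ¬p = contradiction p ¬p
⟦⟧-false (no _)  _  = refl

⟦⟧-cong : (P? : Dec P) (Q? : Dec Q) → (P → Q) → (Q → P) → ⟦ P? ⟧ ≡ ⟦ Q? ⟧
⟦⟧-cong (yes p) Q? to from = sym (⟦⟧-true Q? (to p))
⟦⟧-cong (no ¬p) Q? to from = sym (⟦⟧-false Q? (¬p ∘ from))

⟦⟧-false-* : (P? : Dec P) → ¬ P → ∀ x → ⟦ P? ⟧ * x ≡ 0ℤ
⟦⟧-false-* P? ¬p x = trans (cong (_* x) (⟦⟧-false P? ¬p)) (ℤ.*-zeroˡ x)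

⟦⟧-true-* : (P? : Dec P) → P → ∀ x → ⟦ P? ⟧ * x ≡ x
⟦⟧-true-* P? p x = trans (cong (_* x) (⟦⟧-true P? p)) (ℤ.*-identityˡ x)

-- Finite sums over initial segments.

∑₁-cong : ∀ n {f g} → (∀ d → 0 < d → d ℕ.≤ n → f d ≡ g d) → ∑₁ n f ≡ ∑₁ n g
∑₁-cong zero    f≡g = refl
∑₁-cong (suc n) f≡g =
  cong₂ _+_ (∑₁-cong n λ d 0<d d≤n → f≡g d 0<d (ℕ.m≤n⇒m≤1+n d≤n)) (f≡g (suc n) z<s ℕ.≤-refl)

∑₁-zero : ∀ n → ∑[1≤ d ≤ n ] 0ℤ ≡ 0ℤ
∑₁-zero zero    = refl
∑₁-zero (suc n) = trans (ℤ.+-identityʳ _) (∑₁-zero n)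

∑₁-distrib-+ : ∀ n f g → ∑[1≤ d ≤ n ] (f d + g d) ≡ ∑₁ n f + ∑₁ n g
∑₁-distrib-+ zero    f g = refl
∑₁-distrib-+ (suc n) f g =
  trans (cong (_+ (f (suc n) + g (suc n))) (∑₁-distrib-+ n f g)) (interchange (∑₁ n f) (∑₁ n g) (f (suc n)) (g (suc n)))
  where
  interchange : ∀ a b c d → (a + b) + (c + d) ≡ (a + c) + (b + d)
  interchange = solve-∀

∑₁-neg : ∀ n f → ∑[1≤ d ≤ n ] (- f d) ≡ - ∑₁ n f
∑₁-neg zero    f = refl
∑₁-neg (suc n) f =
  trans (cong (_+ (- f (suc n))) (∑₁-neg n f)) (sym (ℤ.neg-distrib-+ (∑₁ n f) (f (suc n))))

∑₁-split : ∀ k m f → ∑₁ (k ℕ.+ m) f ≡ ∑₁ m f + ∑[1≤ i ≤ k ] f (i ℕ.+ m)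
∑₁-split zero    m f = sym (ℤ.+-identityʳ _)
∑₁-split (suc k) m f =
  trans (cong (_+ f (suc k ℕ.+ m)) (∑₁-split k m f)) (ℤ.+-assoc (∑₁ m f) _ _)

∑₁-truncate : ∀ {m n f} → m ℕ.≤ n → (∀ d → m < d → f d ≡ 0ℤ) → ∑₁ n f ≡ ∑₁ m f
∑₁-truncate {m} {n} {f} m≤n f≡0 = begin
  ∑₁ n f                                       ≡⟨ cong (λ k → ∑₁ k f) (ℕ.m∸n+n≡m m≤n) ⟨
  ∑₁ (n ℕ.∸ m ℕ.+ m) f                         ≡⟨ ∑₁-split (n ℕ.∸ m) m f ⟩
  ∑₁ m f + ∑[1≤ i ≤ n ℕ.∸ m ] f (i ℕ.+ m)      ≡⟨ cong (_+_ (∑₁ m f)) (∑₁-cong (n ℕ.∸ m) λ i 0<i _ →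
                                                    f≡0 (i ℕ.+ m) (ℕ.m<n+m m 0<i)) ⟩
  ∑₁ m f + ∑[1≤ i ≤ n ℕ.∸ m ] 0ℤ               ≡⟨ cong (_+_ (∑₁ m f)) (∑₁-zero (n ℕ.∸ m)) ⟩
  ∑₁ m f + 0ℤ                                  ≡⟨ ℤ.+-identityʳ _ ⟩
  ∑₁ m f                                       ∎

-- Induction on `n` by blocks of `p` consecutive integers: in the block after `n * p` only the last
-- entry, `suc n * p`, is a multiple of `p`.
∑₁-multiples : ∀ p .{{_ : NonZero p}} n (f : ℕ → ℤ) →
  ∑[1≤ d ≤ n ℕ.* p ] (⟦ p ∣? d ⟧ * f d) ≡ ∑[1≤ e ≤ n ] f (e ℕ.* p)
∑₁-multiples p         zero    f = refl
∑₁-multiples p@(suc q) (suc n) f = begin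
  ∑₁ (p ℕ.+ n ℕ.* p) h
    ≡⟨ ∑₁-split p (n ℕ.* p) h ⟩
  ∑₁ (n ℕ.* p) h + (∑[1≤ i ≤ q ] h (i ℕ.+ n ℕ.* p) + h (suc n ℕ.* p))
    ≡⟨ cong₂ _+_ (∑₁-multiples p n f) (cong₂ _+_ nonmultiples (⟦⟧-true-* (p ∣? _) (n∣m*n (suc n)) _)) ⟩
  ∑[1≤ e ≤ n ] f (e ℕ.* p) + (0ℤ + f (suc n ℕ.* p))
    ≡⟨ cong (_+_ (∑[1≤ e ≤ n ] f (e ℕ.* p))) (ℤ.+-identityˡ _) ⟩
  ∑[1≤ e ≤ suc n ] f (e ℕ.* p)
    ∎
  where
  h : ℕ → ℤ
  h d = ⟦ p ∣? d ⟧ * f d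

  p∤ : ∀ i → 0 < i → i ℕ.≤ q → p ∤ i ℕ.+ n ℕ.* p
  p∤ (suc i) _ i≤q p∣ = >⇒∤ (s≤s i≤q)
    (∣m+n∣m⇒∣n (subst (p ∣_) (ℕ.+-comm (suc i) (n ℕ.* p)) p∣) (n∣m*n n))

  nonmultiples : ∑[1≤ i ≤ q ] h (i ℕ.+ n ℕ.* p) ≡ 0ℤ
  nonmultiples = trans
    (∑₁-cong q λ i 0<i i≤q → ⟦⟧-false-* (p ∣? _) (p∤ i 0<i i≤q) _)
    (∑₁-zero q)

-- The Möbius function read off an arbitrary prime factorisation.

-- The body of `μ` with the list of primes as a free argument, so that a factorisation other than
-- the one chosen by `factorise` can be used.
sign : List ℕ → ℤ
sign ps = if does (unique? ps) then -1ℤ ℤ.^ length ps else 0ℤ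

Unique-resp-↭ : ∀ {ps qs : List ℕ} → ps ↭ qs → Unique ps → Unique qs
Unique-resp-↭ = Permutationₛ.Unique-resp-↭ (setoid ℕ) ∘ ↭⇒↭ₛ

sign-unique : ∀ {ps} → Unique ps → sign ps ≡ -1ℤ ℤ.^ length ps
sign-unique {ps} u = cong (if_then -1ℤ ℤ.^ length ps else 0ℤ) (dec-true (unique? ps) u)

sign-¬unique : ∀ {ps} → ¬ Unique ps → sign ps ≡ 0ℤ
sign-¬unique {ps} ¬u = cong (if_then -1ℤ ℤ.^ length ps else 0ℤ) (dec-false (unique? ps) ¬u)

sign-resp-↭ : ∀ {ps qs} → ps ↭ qs → sign ps ≡ sign qs
sign-resp-↭ {ps} {qs} ps↭qs = case unique? ps of λ where
  (yes u) → trans (sign-unique u) (trans (cong (-1ℤ ℤ.^_) (↭-length ps↭qs))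
    (sym (sign-unique (Unique-resp-↭ ps↭qs u))))
  (no ¬u) → trans (sign-¬unique ¬u)
    (sym (sign-¬unique (¬u ∘ Unique-resp-↭ (↭-sym ps↭qs))))

sign-∷-∈ : ∀ {p ps} → p ∈ ps → sign (p ∷ ps) ≡ 0ℤ
sign-∷-∈ {p} {ps} p∈ps = sign-¬unique {p ∷ ps} λ { (p∉ps ∷ _) → All¬⇒¬Any p∉ps p∈ps }

sign-∷-∉ : ∀ {p ps} → p ∉ ps → sign (p ∷ ps) ≡ - sign ps
sign-∷-∉ {p} {ps} p∉ps = case unique? ps of λ where
  (yes u) → trans (sign-unique (¬Any⇒All¬ ps p∉ps ∷ u))
    (trans (ℤ.-1*i≡-i _) (cong -_ (sym (sign-unique u))))
  (no ¬u) → trans (sign-¬unique (¬u ∘ AllPairs.tail)) (cong -_ (sym (sign-¬unique ¬u)))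

-- Prime factorisations are unique up to permutation, and `sign` is invariant under permutations.
μ≡sign : ∀ {n} .{{_ : NonZero n}} (f : PrimeFactorisation n) → μ n ≡ sign (factors f)
μ≡sign {suc n} f = sign-resp-↭ (factorisationUnique (factorise (suc n)) f)

-- Prepending `p` to the factors of `e` gives a factorisation of `e * p`. If `p ∣ e`, then `p`
-- occurs twice and both sides vanish; otherwise one new prime flips the sign.
μ-*-prime : ∀ {p} → Prime p → ∀ e .{{_ : NonZero e}} → μ (e ℕ.* p) ≡ - (⟦ ¬? (p ∣? e) ⟧ * μ e)
μ-*-prime {p} pPrime e = trans (μ≡sign f′) (lemma (p ∣? e))
  where
  instance
    _ = prime⇒nonZero pPrime
    _ = ℕ.m*n≢0 e p

  f : PrimeFactorisation e
  f = factorise e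

  f′ : PrimeFactorisation (e ℕ.* p)
  f′ = record
    { factors         = p ∷ factors f
    ; isFactorisation = trans (ℕ.*-comm e p) (cong (p ℕ.*_) (isFactorisation f))
    ; factorsPrime    = pPrime ∷ factorsPrime f
    }

  lemma : (p∣?e : Dec (p ∣ e)) → sign (p ∷ factors f) ≡ - (⟦ ¬? p∣?e ⟧ * μ e)
  lemma (yes p∣e) = trans
    (sign-∷-∈ (factorisationHasAllPrimeFactors pPrime
      (subst (p ∣_) (isFactorisation f) p∣e) (factorsPrime f)))
    (cong -_ (sym (ℤ.*-zeroˡ (μ e))))
  lemma (no p∤e) = trans
    (sign-∷-∉ {p} {factors f} λ p∈ps → p∤e (subst (p ∣_) (sym (isFactorisation f)) (∈⇒∣product p∈ps)))
    (cong -_ (trans (sym (μ≡sign f)) (sym (ℤ.*-identityˡ (μ e)))))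

-- Sums of the Möbius function over divisors.

-- Divisors of hp not divisible by p are divisors of h; those divisible by p are
-- the ep with e ∣ h, and μ(ep) is −μ(e) or 0.  The two parts cancel.
∑μ[d∣h*p]≡0 : ∀ {p} → Prime p → ∀ h .{{_ : NonZero h}} →
  ∑[1≤ d ≤ h ℕ.* p ] (⟦ d ∣? h ℕ.* p ⟧ * μ d) ≡ 0ℤ
∑μ[d∣h*p]≡0 {p} pPrime h = begin
  ∑[1≤ d ≤ h ℕ.* p ] u d
    ≡⟨ ∑₁-cong (h ℕ.* p) (λ d _ _ → u-split d) ⟩
  ∑[1≤ d ≤ h ℕ.* p ] (w d + ⟦ p ∣? d ⟧ * u d)
    ≡⟨ ∑₁-distrib-+ (h ℕ.* p) w _ ⟩
  ∑₁ (h ℕ.* p) w + ∑[1≤ d ≤ h ℕ.* p ] (⟦ p ∣? d ⟧ * u d)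
    -- `w` is supported on divisors of `h`, so its sum may stop at `h`; the other sum is reindexed
    -- by `d = e * p`.
    ≡⟨ cong₂ _+_
         (∑₁-truncate (ℕ.m≤m*n h p) λ d h<d → ⟦⟧-false-* (d ∣? h) (>⇒∤ h<d) _)
         (∑₁-multiples p h u) ⟩
  ∑₁ h w + ∑[1≤ e ≤ h ] u (e ℕ.* p)
    ≡⟨ cong (_+_ (∑₁ h w)) (∑₁-cong h λ e 0<e _ → u-multiple e 0<e) ⟩
  ∑₁ h w + ∑[1≤ e ≤ h ] (- w e)
    ≡⟨ cong (_+_ (∑₁ h w)) (∑₁-neg h w) ⟩
  ∑₁ h w + - ∑₁ h w
    ≡⟨ ℤ.+-inverseʳ (∑₁ h w) ⟩
  0ℤ
    ∎
  where
  instance _ = prime⇒nonZero pPrime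

  u w : ℕ → ℤ
  u d = ⟦ d ∣? h ℕ.* p ⟧ * μ d
  w d = ⟦ d ∣? h ⟧ * (⟦ ¬? (p ∣? d) ⟧ * μ d)

  p∤d∣hp⇒d∣h : ∀ {d} → p ∤ d → d ∣ h ℕ.* p → d ∣ h
  p∤d∣hp⇒d∣h {d} p∤d (divides q hp≡qd)
    -- As `p` divides `q * d` but not `d`, it divides the cofactor `q`, and cancelling `p` leaves
    -- `d ∣ h`.
    with euclidsLemma q d pPrime (divides h (sym hp≡qd))
  ... | inj₂ p∣d = contradiction p∣d p∤d
  ... | inj₁ (divides r refl) = divides r (ℕ.*-cancelʳ-≡ h (r ℕ.* d) p (begin
    h ℕ.* p           ≡⟨ hp≡qd ⟩
    r ℕ.* p ℕ.* d     ≡⟨ ℕ.*-assoc r p d ⟩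
    r ℕ.* (p ℕ.* d)   ≡⟨ cong (r ℕ.*_) (ℕ.*-comm p d) ⟩
    r ℕ.* (d ℕ.* p)   ≡⟨ ℕ.*-assoc r d p ⟨
    r ℕ.* d ℕ.* p     ∎))

  u-split : ∀ d → u d ≡ w d + ⟦ p ∣? d ⟧ * u d
  u-split d with p ∣? d
  ... | yes _  = sym (trans
    (cong₂ _+_ (trans (cong (⟦ d ∣? h ⟧ *_) (ℤ.*-zeroˡ (μ d))) (ℤ.*-zeroʳ ⟦ d ∣? h ⟧)) (ℤ.*-identityˡ (u d)))
    (ℤ.+-identityˡ (u d)))
  ... | no p∤d = sym (begin
    ⟦ d ∣? h ⟧ * (1ℤ * μ d) + 0ℤ * u d ≡⟨ cong₂ _+_ (cong (⟦ d ∣? h ⟧ *_) (ℤ.*-identityˡ (μ d))) (ℤ.*-zeroˡ (u d)) ⟩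
    ⟦ d ∣? h ⟧ * μ d + 0ℤ              ≡⟨ ℤ.+-identityʳ _ ⟩
    ⟦ d ∣? h ⟧ * μ d                   ≡⟨ cong (_* μ d) (⟦⟧-cong (d ∣? h) (d ∣? h ℕ.* p) (∣m⇒∣m*n p) (p∤d∣hp⇒d∣h p∤d)) ⟩
    u d                                ∎)

  u-multiple : ∀ e → 0 < e → u (e ℕ.* p) ≡ - w e
  u-multiple e@(suc _) _ = begin
    ⟦ e ℕ.* p ∣? h ℕ.* p ⟧ * μ (e ℕ.* p)
      ≡⟨ cong₂ _*_ (⟦⟧-cong (e ℕ.* p ∣? h ℕ.* p) (e ∣? h) (*-cancelʳ-∣ p) (*-monoˡ-∣ p)) (μ-*-prime pPrime e) ⟩
    ⟦ e ∣? h ⟧ * - (⟦ ¬? (p ∣? e) ⟧ * μ e)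
      ≡⟨ ℤ.neg-distribʳ-* ⟦ e ∣? h ⟧ _ ⟨
    - w e
      ∎

-- No `d > g` divides a positive `g`, so the sum may stop at `g`. If `g` has a prime factor `p`,
-- writing `g = h * p` makes the sum vanish; an empty factorisation means `g = 1`.
∑μ[d∣g]≡⟦g≡1⟧ : ∀ {n} g → 0 < g → g ℕ.≤ n → ∑[1≤ d ≤ n ] (⟦ d ∣? g ⟧ * μ d) ≡ ⟦ g ≟ 1 ⟧
∑μ[d∣g]≡⟦g≡1⟧ {n} g@(suc _) 0<g g≤n = trans
  (∑₁-truncate g≤n λ d g<d → ⟦⟧-false-* (d ∣? g) (>⇒∤ g<d) (μ d))
  (sum (factorise g))
  where
  sum : PrimeFactorisation g → ∑[1≤ d ≤ g ] (⟦ d ∣? g ⟧ * μ d) ≡ ⟦ g ≟ 1 ⟧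
  sum record { factors = [] ; isFactorisation = refl } = refl
  sum record { factors = p ∷ ps ; isFactorisation = g≡p*h ; factorsPrime = pPrime ∷ psPrime } = begin
    ∑[1≤ d ≤ g ] (⟦ d ∣? g ⟧ * μ d)
      ≡⟨ cong (λ k → ∑[1≤ d ≤ k ] (⟦ d ∣? k ⟧ * μ d)) g≡h*p ⟩
    ∑[1≤ d ≤ h ℕ.* p ] (⟦ d ∣? h ℕ.* p ⟧ * μ d)
      ≡⟨ ∑μ[d∣h*p]≡0 pPrime h {{productOfPrimes≢0 psPrime}} ⟩
    0ℤ
      ≡⟨ ⟦⟧-false (g ≟ 1) g≢1 ⟨
    ⟦ g ≟ 1 ⟧
      ∎
    where
    h = product ps

    g≡h*p : g ≡ h ℕ.* p
    g≡h*p = trans g≡p*h (ℕ.*-comm p h)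

    g≢1 : g ≢ 1
    g≢1 g≡1 = ¬prime[1] (subst Prime (ℕ.m*n≡1⇒m≡1 p h (trans (sym g≡p*h) g≡1)) pPrime)

-- Counting sublists with gcd 1.

-- The number of sublists B of L with gcd(g, gcd B) = 1.
coprimeSublists : ℕ → List ℕ → ℕ
coprimeSublists g []      = if does (g ≟ 1) then 1 else 0
coprimeSublists g (x ∷ L) = coprimeSublists g L ℕ.+ coprimeSublists (gcd g x) L

-- Enlarging a sublist replaces its gcd by a divisor of it. So the gcd over all of `L` divides the
-- gcd over each sublist, and none of these is 1 unless the former is.
coprimeSublists≡0 : ∀ g L → gcd g (foldr gcd 0 L) ≢ 1 → coprimeSublists g L ≡ 0
coprimeSublists≡0 g [] gcd≢1 =
  cong (if_then 1 else 0) (dec-false (g ≟ 1) (gcd≢1 ∘ trans (gcd-identityʳ g)))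
coprimeSublists≡0 g (x ∷ L) gcd≢1 = cong₂ ℕ._+_
  (coprimeSublists≡0 g L λ gcd≡1 → gcd≢1 (∣1⇒≡1 (subst (gcd g (gcd x G) ∣_) gcd≡1
    (gcd-greatest (gcd[m,n]∣m g _) (∣-trans (gcd[m,n]∣n g _) (gcd[m,n]∣n x G))))))
  (coprimeSublists≡0 (gcd g x) L (gcd≢1 ∘ trans (sym (gcd-assoc g x G))))
  where G = foldr gcd 0 L

-- The full list `L` is itself one of the sublists counted: always follow the branch that takes `x`.
coprimeSublists≢0 : ∀ g L → gcd g (foldr gcd 0 L) ≡ 1 → coprimeSublists g L ≢ 0
coprimeSublists≢0 g [] gcd≡1 = subst (_≢ 0) (sym count≡1) λ ()
  where
  count≡1 : coprimeSublists g [] ≡ 1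
  count≡1 = cong (if_then 1 else 0) (dec-true (g ≟ 1) (trans (sym (gcd-identityʳ g)) gcd≡1))
coprimeSublists≢0 g (x ∷ L) gcd≡1 =
  coprimeSublists≢0 (gcd g x) L (trans (gcd-assoc g x (foldr gcd 0 L)) gcd≡1)
  ∘ ℕ.m+n≡0⇒n≡0 (coprimeSublists g L)

-- The weighted Möbius sum as a sum over sublists.

multiples : List ℕ → ℕ → ℕ
multiples L d = length (filter (d ∣?_) L)

-- Here `g` is the gcd of the elements already chosen and `L` holds those still undecided. At
-- `g = 0`, where nothing has been chosen, the indicator is always 1.
weightedSum : ℕ → ℕ → List ℕ → ℤ
weightedSum n g L = ∑[1≤ d ≤ n ] (⟦ d ∣? g ⟧ * (μ d * + (2 ^ multiples L d)))

weightedSum-[] : ∀ n g → weightedSum n g [] ≡ ∑[1≤ d ≤ n ] (⟦ d ∣? g ⟧ * μ d)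
weightedSum-[] n g = ∑₁-cong n λ d _ _ → cong (⟦ d ∣? g ⟧ *_) (ℤ.*-identityʳ (μ d))

-- The two terms leave `x` out and take it. If `d ∣ x`, the power of 2 doubles, and `d ∣ g` is
-- equivalent to `d ∣ gcd g x`; otherwise the power is unchanged and the second term vanishes.
weightedSum-∷ : ∀ n g x L → weightedSum n g (x ∷ L) ≡ weightedSum n g L + weightedSum n (gcd g x) L
weightedSum-∷ n g x L = trans (∑₁-cong n λ d _ _ → pointwise d) (∑₁-distrib-+ n _ _)
  where
  double : ∀ m k → m * + (2 ^ suc k) ≡ m * + (2 ^ k) + m * + (2 ^ k)
  double m k = trans
    (cong (λ j → m * + (2 ^ k ℕ.+ j)) (ℕ.+-identityʳ (2 ^ k)))
    (trans (cong (m *_) (ℤ.pos-+ (2 ^ k) (2 ^ k))) (ℤ.*-distribˡ-+ m _ _))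

  pointwise : ∀ d →
    ⟦ d ∣? g ⟧ * (μ d * + (2 ^ multiples (x ∷ L) d)) ≡
    ⟦ d ∣? g ⟧ * (μ d * + (2 ^ multiples L d)) + ⟦ d ∣? gcd g x ⟧ * (μ d * + (2 ^ multiples L d))
  pointwise d with d ∣? x
  ... | yes d∣x = begin
    a * (μ d * + (2 ^ suc k))          ≡⟨ cong (a *_) (double (μ d) k) ⟩
    a * (b + b)                        ≡⟨ ℤ.*-distribˡ-+ a b b ⟩
    a * b + a * b                      ≡⟨ cong (λ c → a * b + c * b) (⟦⟧-cong (d ∣? g) (d ∣? gcd g x)
                                            (λ d∣g → gcd-greatest d∣g d∣x)
                                            (λ d∣gcd → ∣-trans d∣gcd (gcd[m,n]∣m g x))) ⟩
    a * b + ⟦ d ∣? gcd g x ⟧ * b       ∎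
    where
    a = ⟦ d ∣? g ⟧
    k = multiples L d
    b = μ d * + (2 ^ k)
  ... | no d∤x = sym (trans
    (cong (_+_ (⟦ d ∣? g ⟧ * (μ d * + (2 ^ multiples L d)))) (⟦⟧-false-* (d ∣? gcd g x) (λ d∣gcd → d∤x (∣-trans d∣gcd (gcd[m,n]∣n g x))) _))
    (ℤ.+-identityʳ _))

-- The bound `g ≤ n` puts all divisors of `g` in the range of summation, so the divisor sum is
-- complete at the end of the list. Both bounds pass to `gcd g x`, a nonzero divisor of `g`.
weightedSum-positive : ∀ {n} g → 0 < g → g ℕ.≤ n → ∀ L → weightedSum n g L ≡ + coprimeSublists g L
weightedSum-positive {n} g 0<g g≤n [] =
  trans (weightedSum-[] n g) (trans (∑μ[d∣g]≡⟦g≡1⟧ g 0<g g≤n) (⟦⟧≡+ (g ≟ 1)))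
  where
  ⟦⟧≡+ : (P? : Dec P) → ⟦ P? ⟧ ≡ + (if does P? then 1 else 0)
  ⟦⟧≡+ (yes _) = refl
  ⟦⟧≡+ (no _)  = refl
weightedSum-positive {n} g@(suc _) 0<g g≤n (x ∷ L) = begin
  weightedSum n g (x ∷ L)
    ≡⟨ weightedSum-∷ n g x L ⟩
  weightedSum n g L + weightedSum n (gcd g x) L
    ≡⟨ cong₂ _+_ (weightedSum-positive g 0<g g≤n L)
         (weightedSum-positive (gcd g x) (ℕ.n≢0⇒n>0 (gcd[m,n]≢0 g x (inj₁ λ ())))
           (ℕ.≤-trans (∣⇒≤ (gcd[m,n]∣m g x)) g≤n) L) ⟩
  + coprimeSublists g L + + coprimeSublists (gcd g x) L
    ≡⟨ ℤ.pos-+ (coprimeSublists g L) _ ⟨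
  + coprimeSublists g (x ∷ L)
    ∎

-- As long as nothing is chosen `g` stays 0, and the empty sublist yields `M n`. Choosing a first
-- element `x` makes the gcd `x`, which is positive and at most `n`.
weightedSum-zero : ∀ {n} L → All (0 <_) L → All (ℕ._≤ n) L →
  weightedSum n 0 L ≡ M n + + coprimeSublists 0 L
-- The empty sublist has gcd 0, not 1, so `coprimeSublists 0 []` computes to 0.
weightedSum-zero {n} [] [] [] = trans (weightedSum-[] n 0)
  (trans (∑₁-cong n λ d _ _ → ⟦⟧-true-* (d ∣? 0) (d ∣0) (μ d)) (sym (ℤ.+-identityʳ (M n))))
weightedSum-zero {n} (x ∷ L) (0<x ∷ 0<L) (x≤n ∷ L≤n) = begin
  weightedSum n 0 (x ∷ L)
    ≡⟨ weightedSum-∷ n 0 x L ⟩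
  weightedSum n 0 L + weightedSum n (gcd 0 x) L
    ≡⟨ cong₂ _+_ (weightedSum-zero L 0<L L≤n)
         (weightedSum-positive (gcd 0 x) (subst (0 <_) x≡gcd 0<x) (subst (ℕ._≤ n) x≡gcd x≤n) L) ⟩
  M n + + coprimeSublists 0 L + + coprimeSublists (gcd 0 x) L
    ≡⟨ ℤ.+-assoc (M n) _ _ ⟩
  M n + (+ coprimeSublists 0 L + + coprimeSublists (gcd 0 x) L)
    ≡⟨ cong (_+_ (M n)) (ℤ.pos-+ (coprimeSublists 0 L) _) ⟨
  M n + + coprimeSublists 0 (x ∷ L)
    ∎
  where x≡gcd = sym (gcd-identityˡ x)

-- The inequality and its equality case.

gcdSet≡foldr : ∀ x xs → gcdSet (x ∷ xs) ≡ foldr gcd 0 (x ∷ xs)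
gcdSet≡foldr x []       = sym (gcd-identityʳ x)
gcdSet≡foldr x (y ∷ ys) = cong (gcd x) (gcdSet≡foldr y ys)

theorem4p3 : (A : List⁺ ℕ) → Unique (toList A) → All (0 <_) (toList A) →
    (M (sup A) ≤ (∑[1≤ d ≤ sup A ] (μ d * + (2 ^ v A d)))) ×
    ((M (sup A) ≡ (∑[1≤ d ≤ sup A ] (μ d * + (2 ^ v A d)))) ⇔ (1 < gcdSet A))
theorem4p3 A@(x ∷ xs) _ A>0@(0<x ∷ _) = subst (M N ≤_) (sym difference) (ℤ.i≤i+j (M N) (+ c)) , mk⇔ to from
  where
  N = sup A
  c = coprimeSublists 0 (toList A)
  G = foldr gcd 0 (toList A)

  difference : ∑[1≤ d ≤ N ] (μ d * + (2 ^ v A d)) ≡ M N + + c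
  difference = trans
    -- Every `d` divides 0, so the indicator of `d ∣ 0` can be inserted for free.
    (∑₁-cong N λ d _ _ → sym (⟦⟧-true-* (d ∣? 0) (d ∣0) _))
    (weightedSum-zero (toList A) A>0 (⊥≤max x xs ∷ xs≤max x xs))

  G≢0 : G ≢ 0
  G≢0 = gcd[m,n]≢0 x _ (inj₁ (ℕ.m<n⇒n≢0 0<x))

  to : M N ≡ ∑[1≤ d ≤ N ] (μ d * + (2 ^ v A d)) → 1 < gcdSet A
  to eq = subst (1 <_) (sym (gcdSet≡foldr x xs))
    -- Since `G` is positive, only `G = 1` has to be excluded; in that case `A` itself would be
    -- counted by `c`, which equality forces to be 0.
    (ℕ.≤∧≢⇒< (ℕ.n≢0⇒n>0 G≢0) λ 1≡G →
      coprimeSublists≢0 0 (toList A) (trans (gcd-identityˡ G) (sym 1≡G)) c≡0)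
    where
    c≡0 : c ≡ 0
    c≡0 = ℤ.+-injective (+-cancelˡ (M N) (+ c) 0ℤ (begin
      M N + + c ≡⟨ trans eq difference ⟨
      M N       ≡⟨ ℤ.+-identityʳ (M N) ⟨
      M N + 0ℤ  ∎))

  from : 1 < gcdSet A → M N ≡ ∑[1≤ d ≤ N ] (μ d * + (2 ^ v A d))
  from 1<gcd = sym (begin
    ∑[1≤ d ≤ N ] (μ d * + (2 ^ v A d)) ≡⟨ difference ⟩
    M N + + c                          ≡⟨ cong (λ k → M N + + k) (coprimeSublists≡0 0 (toList A) G≢1) ⟩
    M N + 0ℤ                           ≡⟨ ℤ.+-identityʳ (M N) ⟩
    M N                                ∎)
    where
    G≢1 : gcd 0 G ≢ 1
    G≢1 gcd≡1 = ℕ.<⇒≢ 1<gcd (sym (trans (gcdSet≡foldr x xs) (trans (sym (gcd-identityˡ G)) gcd≡1)))
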